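{- Let $n$ be odd. The following quantities are all equal: (i) the number of species containing symmetric Latin squares of order $n$; (ii) the number of species containing diagonal symmetric Latin squares of order $n$; (iii) the number of species containing idempotent symmetric Latin squares of order $n$; (iv) the number of isotopism classes containing idempotent symmetric Latin squares of order $n$; (v) the number of rrs-isotopism classes containing idempotent symmetric Latin squares of order $n$; (vi) the number of isomorphism classes of idempotent symmetric Latin squares of order $n$; (vii) the number of isomorphism classes containing unipotent symmetric reduced Latin squares of order $n+1$.
   Context: A Latin square of order $n$ is a set of $n^2$ triples (row, column, symbol) over $\{1,\dots,n\}$, distinct triples agreeing in at most one coordinate; it is symmetric if it equals its transpose; reduced if its first row and column are $1,\dots,n$ in order; unipotent if all main diagonal entries are equal; diagonal if the main diagonal entries are distinct; idempotent if cell $(i,i)$ contains $i$ for all $i$. An isotopism $(\alpha,\beta,\gamma)\in\mathcal{S}_n^3$ maps $(r,c,s)$ to $(r^\alpha,c^\beta,s^\gamma)$; it is an rrs-isotopism if $\alpha=\beta$ and an isomorphism if $\alpha=\beta=\gamma$. A paratopism is an isotopism combined with a uniform permutation of the three coordinates of all triples; species are paratopism classes. A class "containing" squares with a property means a class containing at least one such square. -}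

module Defs where

open import Data.Nat using (ℕ; suc)
open import Data.Fin using (Fin; zero; suc)
open import Data.Fin.Permutation using (Permutation′; _⟨$⟩ʳ_)
open import Data.Product using (Σ; ∃; _×_)
open import Function.Bundles using (_⇔_)
open import Function.Definitions using (Injective)
open import Relation.Binary.PropositionalEquality using (_≡_)

-- A triple (row, column, symbol) over Fin n, indexed by coordinate 0,1,2.
Triple : ℕ → Set
Triple n = Fin 3 → Fin n

tri : ∀ {n} → Fin n → Fin n → Fin n → Triple n
tri a b c zero = a
tri a b c (suc zero) = b
tri a b c (suc (suc zero)) = c

record LatinSquare (n : ℕ) : Set where
  field
    cell    : Fin n → Fin n → Fin n
    rowInj  : ∀ r → Injective _≡_ _≡_ (cell r)
    colInj  : ∀ c → Injective _≡_ _≡_ (λ r → cell r c)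
open LatinSquare public

_∋_ : ∀ {n} → LatinSquare n → Triple n → Set
L ∋ t = cell L (t zero) (t (suc zero)) ≡ t (suc (suc zero))

Symmetric : ∀ {n} → LatinSquare n → Set
Symmetric L = ∀ r c → cell L r c ≡ cell L c r

Reduced : ∀ {n} → LatinSquare (suc n) → Set
Reduced L = (∀ i → cell L zero i ≡ i) × (∀ i → cell L i zero ≡ i)

Unipotent : ∀ {n} → LatinSquare n → Set
Unipotent L = ∀ i j → cell L i i ≡ cell L j j

Diagonal : ∀ {n} → LatinSquare n → Set
Diagonal L = Injective _≡_ _≡_ (λ i → cell L i i)

Idempotent : ∀ {n} → LatinSquare n → Set
Idempotent L = ∀ i → cell L i i ≡ i

isoMap : ∀ {n} → Permutation′ n → Permutation′ n → Permutation′ n → Triple n → Triple n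
isoMap α β γ t = tri (α ⟨$⟩ʳ t zero) (β ⟨$⟩ʳ t (suc zero)) (γ ⟨$⟩ʳ t (suc (suc zero)))

permCoords : ∀ {n} → Permutation′ 3 → Triple n → Triple n
permCoords σ t i = t (σ ⟨$⟩ʳ i)

-- M is the image of L under the map f on triples
-- (f is a bijection on triples in all uses below)
_maps_to_ : ∀ {n} → (Triple n → Triple n) → LatinSquare n → LatinSquare n → Set
f maps L to M = ∀ t → (L ∋ t) ⇔ (M ∋ f t)

Isotopic : ∀ {n} → LatinSquare n → LatinSquare n → Set
Isotopic {n} L M = Σ (Permutation′ n) λ α → Σ (Permutation′ n) λ β → Σ (Permutation′ n) λ γ →
  isoMap α β γ maps L to M

RRSIsotopic : ∀ {n} → LatinSquare n → LatinSquare n → Set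
RRSIsotopic {n} L M = Σ (Permutation′ n) λ α → Σ (Permutation′ n) λ γ →
  isoMap α α γ maps L to M

Isomorphic : ∀ {n} → LatinSquare n → LatinSquare n → Set
Isomorphic {n} L M = Σ (Permutation′ n) λ α → isoMap α α α maps L to M

Paratopic : ∀ {n} → LatinSquare n → LatinSquare n → Set
Paratopic {n} L M = Σ (Permutation′ 3) λ σ →
  Σ (Permutation′ n) λ α → Σ (Permutation′ n) λ β → Σ (Permutation′ n) λ γ →
  (λ t → isoMap α β γ (permCoords σ t)) maps L to M

-- "The number of R-classes containing a square with property P is k":
-- there are k squares with property P, pairwise not R-related, such that every
-- square with property P is R-related to one of them (R is an equivalence relation).
NumClasses : ∀ {n} → (LatinSquare n → LatinSquare n → Set) → (LatinSquare n → Set) → ℕ → Set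
NumClasses {n} R P k =
  Σ (Fin k → LatinSquare n) λ rep →
    (∀ i → P (rep i)) ×
    (∀ i j → R (rep i) (rep j) → i ≡ j) ×
    (∀ L → P L → ∃ λ i → R L (rep i))

{-# OPTIONS --safe #-}
-- In a symmetric square of odd order every symbol s occurs on the diagonal,
-- because r ↦ (the column of s in row r) is an involution of a set of odd size;
-- so relabelling symbols makes the square idempotent.
-- If symmetric squares L, M are related by a paratopism moving the symbol
-- coordinate, then L inherits from M a second transposition in its
-- autoparatopism group, so every coordinate permutation is realised there and
-- L, M are isotopic.
-- If (α, β, γ) is an isotopism between idempotent symmetric squares, then
-- φ = α⁻¹β satisfies L(φx, y) = L(x, φy), hence ⟨φ⟩ acts semiregularly and φ has
-- odd order; a square root of φ in ⟨φ⟩ turns (α, β, γ) into an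
-- rrs-isotopism, which by idempotence is the isomorphism γ.
-- Bordering an idempotent symmetric square gives the squares of order n + 1.
module Submission where

open import Defs
open import Data.Fin using (Fin; zero; suc; toℕ; punchOut; finToFun; funToFin)
open import Data.Fin.Patterns using (0F; 1F; 2F)
import Data.Fin.Permutation as Perm
open import Data.Fin.Permutation using (Permutation′; _⟨$⟩ʳ_; _⟨$⟩ˡ_; _∘ₚ_)
open import Data.Fin.Properties using (_≟_; _<?_; <-cmp; any?; all?; suc-injective; 0≢1+n; pigeonhole; punchOut-injective; injective⇒≤; finToFun-funToFin)
open import Data.List using (List; []; [_]; concatMap; allFin; deduplicate; length; lookup)
open import Data.List.Membership.Propositional using (lose)
open import Data.List.Membership.Propositional.Properties using (∈-allFin; ∈-lookup)
import Data.List.Relation.Unary.All as All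
open import Data.List.Relation.Unary.AllPairs using (AllPairs; _∷_)
open import Data.List.Relation.Unary.Any as Any using (Any; here)
import Data.List.Relation.Unary.Any.Properties as Any
open import Data.List.Relation.Unary.Unique.DecSetoid.Properties using (deduplicate-!)
open import Data.Nat using (ℕ; zero; suc; _+_; _*_; _^_; _<_; z<s; s<s)
open import Data.Nat.DivMod using (_%_; m*n%n≡0)
open import Data.Nat.GeneralisedArithmetic using (fold; fold-+)
open import Data.Nat.Induction using (<-rec)
import Data.Nat.Properties as ℕ
open import Algebra.Properties.CommutativeMonoid.Sum ℕ.+-0-commutativeMonoid using (sum; sum-cong-≗; ∑-distrib-+; sum-permute)
open import Data.Product using (Σ; ∃; _×_; _,_; proj₁; proj₂)
open import Data.Sum using (_⊎_; inj₁; inj₂)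
open import Function.Base using (_∘_)
open import Function.Bundles using (_⇔_; mk⇔; Equivalence; Injection)
open import Function.Definitions using (Injective; StrictlySurjective)
open import Function.Properties.Inverse using (↔⇒↣)
open import Level using (0ℓ)
open import Relation.Binary.Bundles using (DecSetoid)
open import Relation.Binary.Definitions using (tri<; tri≈; tri>)
open import Relation.Binary.PropositionalEquality using (_≡_; _≢_; refl; sym; trans; cong; cong₂; subst; ≢-sym; module ≡-Reasoning)
open import Relation.Nullary using (¬_; Dec; yes; no; contradiction)
open import Relation.Nullary.Decidable using (map′; _×-dec_; _→-dec_)

open ≡-Reasoning
open Equivalence using (to; from)

private
  variable
    n : ℕ

-- Functions on finite sets

permutation-injective : (π : Permutation′ n) → Injective _≡_ _≡_ (π ⟨$⟩ʳ_)
permutation-injective π = Injection.injective (↔⇒↣ π)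

-- If `y` were missed, punching it out of the codomain would inject `Fin (suc n)` into `Fin n`.
injective⇒surjective : {f : Fin n → Fin n} → Injective _≡_ _≡_ f → StrictlySurjective _≡_ f
injective⇒surjective {suc n} {f} f-inj y with any? (λ x → f x ≟ y)
... | yes hit = hit
... | no miss = contradiction (injective⇒≤ punched-injective) ℕ.1+n≰n
  where
  y≢f : ∀ x → y ≢ f x
  y≢f x y≡fx = miss (x , sym y≡fx)

  punched-injective : Injective _≡_ _≡_ (λ x → punchOut (y≢f x))
  punched-injective eq = f-inj (punchOut-injective (y≢f _) (y≢f _) eq)

sum-const-1 : ∀ n → sum {n} (λ _ → 1) ≡ n
sum-const-1 zero    = refl
sum-const-1 (suc n) = cong suc (sum-const-1 n)

private
  ascent : Fin n → Fin n → ℕ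
  ascent x y with x <? y
  ... | yes _ = 1
  ... | no  _ = 0

  ascent-total : {x y : Fin n} → x ≢ y → ascent x y + ascent y x ≡ 1
  ascent-total {x = x} {y} x≢y with x <? y | y <? x | <-cmp x y
  ... | yes _   | yes y<x | tri< _ _ y≮x = contradiction y<x y≮x
  ... | yes x<y | yes _   | tri> x≮y _ _ = contradiction x<y x≮y
  ... | yes _   | no  _   | _            = refl
  ... | no  _   | yes _   | _            = refl
  ... | no  x≮y | no  _   | tri< x<y _ _ = contradiction x<y x≮y
  ... | no  _   | no  y≮x | tri> _ _ y<x = contradiction y<x y≮x
  ... | _       | _       | tri≈ _ x≡y _ = contradiction x≡y x≢y

-- A fixed-point-free involution f exchanges {x < f x} with {f x < x}.
involution-fixedPoint : n % 2 ≡ 1 → (f : Fin n → Fin n) → (∀ x → f (f x) ≡ x) → ∃ λ x → f x ≡ x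
involution-fixedPoint {n} odd f inv with any? (λ x → f x ≟ x)
... | yes fixed = fixed
... | no  free  = contradiction (trans (sym odd) (trans (cong (_% 2) n≡s*2) (m*n%n≡0 s 2))) ℕ.1+n≢0
  where
  up down : Fin n → ℕ
  up   x = ascent x (f x)
  down x = ascent (f x) x

  s = sum up

  sum-down≡s : sum down ≡ s
  sum-down≡s = sym (begin
    -- `f` is its own inverse, so summing over `f x` instead of `x` turns ascents into descents;
    -- both number `s`, which makes `n` even.
    sum up        ≡⟨ sum-permute up (Perm.permutation f f inv inv) ⟩
    sum (up ∘ f)  ≡⟨ sum-cong-≗ (λ x → cong (ascent (f x)) (inv x)) ⟩
    sum down      ∎)

  n≡s*2 : n ≡ s * 2
  n≡s*2 = begin
    n                           ≡⟨ sum-const-1 n ⟨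
    sum {n} (λ _ → 1)           ≡⟨ sum-cong-≗ (λ x → sym (ascent-total (λ x≡fx → free (x , sym x≡fx)))) ⟩
    sum (λ x → up x + down x)   ≡⟨ ∑-distrib-+ up down ⟩
    s + sum down                ≡⟨ cong (s +_) (trans sum-down≡s (sym (ℕ.+-identityʳ s))) ⟩
    2 * s                       ≡⟨ ℕ.*-comm 2 s ⟩
    s * 2                       ∎

-- Isotopisms

maps⇒hom : (L M : LatinSquare n) (α β γ : Permutation′ n) → isoMap α β γ maps L to M →
           ∀ r c → cell M (α ⟨$⟩ʳ r) (β ⟨$⟩ʳ c) ≡ γ ⟨$⟩ʳ cell L r c
maps⇒hom L M α β γ m r c = to (m (tri r c (cell L r c))) refl

-- Injectivity of `γ` supplies the backward implication on triples, so an isotopism may be handled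
-- as a single equation between cells.
hom⇒maps : (L M : LatinSquare n) (α β γ : Permutation′ n) →
           (∀ r c → cell M (α ⟨$⟩ʳ r) (β ⟨$⟩ʳ c) ≡ γ ⟨$⟩ʳ cell L r c) → isoMap α β γ maps L to M
hom⇒maps L M α β γ h t = mk⇔
  (λ t∈L → trans (h _ _) (cong (γ ⟨$⟩ʳ_) t∈L))
  (λ t∈M → permutation-injective γ (trans (sym (h _ _)) t∈M))

isotopic-trans : {L M N : LatinSquare n} → Isotopic L M → Isotopic M N → Isotopic L N
isotopic-trans (α , β , γ , p) (α′ , β′ , γ′ , q) =
  α ∘ₚ α′ , β ∘ₚ β′ , γ ∘ₚ γ′ , λ t → let u = isoMap α β γ t in
  mk⇔ (to (q u) ∘ to (p t)) (from (p t) ∘ from (q u))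

isomorphic-trans : {L M N : LatinSquare n} → Isomorphic L M → Isomorphic M N → Isomorphic L N
isomorphic-trans (α , p) (β , q) =
  α ∘ₚ β , λ t → let u = isoMap α α α t in
  mk⇔ (to (q u) ∘ to (p t)) (from (p t) ∘ from (q u))

isomorphic-sym : {L M : LatinSquare n} → Isomorphic L M → Isomorphic M L
isomorphic-sym {L = L} {M} (α , p) = Perm.flip α , hom⇒maps M L α⁻¹ α⁻¹ α⁻¹ λ r c →
  permutation-injective α (begin
    α ⟨$⟩ʳ cell L (α ⟨$⟩ˡ r) (α ⟨$⟩ˡ c)                    ≡⟨ maps⇒hom L M α α α p _ _ ⟨
    cell M (α ⟨$⟩ʳ (α ⟨$⟩ˡ r)) (α ⟨$⟩ʳ (α ⟨$⟩ˡ c))         ≡⟨ cong₂ (cell M) (Perm.inverseʳ α) (Perm.inverseʳ α) ⟩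
    cell M r c                                            ≡⟨ Perm.inverseʳ α ⟨
    α ⟨$⟩ʳ (α ⟨$⟩ˡ cell M r c)                             ∎)
  where α⁻¹ = Perm.flip α

cells≗⇒isomorphic : (L M : LatinSquare n) → (∀ r c → cell L r c ≡ cell M r c) → Isomorphic L M
cells≗⇒isomorphic L M eq = Perm.id , hom⇒maps L M Perm.id Perm.id Perm.id (λ r c → sym (eq r c))

isomorphic⇒rrsIsotopic : {L M : LatinSquare n} → Isomorphic L M → RRSIsotopic L M
isomorphic⇒rrsIsotopic (α , m) = α , α , m

rrsIsotopic⇒isotopic : {L M : LatinSquare n} → RRSIsotopic L M → Isotopic L M
rrsIsotopic⇒isotopic (α , γ , m) = α , α , γ , m

isotopic⇒paratopic : {L M : LatinSquare n} → Isotopic L M → Paratopic L M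
isotopic⇒paratopic (α , β , γ , m) = Perm.id , α , β , γ , m

-- Paratopisms between symmetric squares

module _ (L M : LatinSquare n) (L-sym : Symmetric L) (M-sym : Symmetric M) where

  private
    symᴸ : ∀ {x y z} → cell L x y ≡ z → cell L y x ≡ z
    symᴸ = trans (L-sym _ _)

    symᴹ : ∀ {x y z} → cell M x y ≡ z → cell M y x ≡ z
    symᴹ = trans (M-sym _ _)

  -- Conjugating the symmetry of M by the given paratopism yields
  -- (y, w, v) ∈ L from (x, y, z) ∈ L, where v = β⁻¹αx and w = α⁻¹βz.
  cyclicParatopism⇒isotopic :
    (α β γ : Permutation′ n) →
    (∀ x y z → (cell L x y ≡ z) ⇔ (cell M (α ⟨$⟩ʳ y) (β ⟨$⟩ʳ z) ≡ γ ⟨$⟩ʳ x)) →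
    Isotopic L M
  cyclicParatopism⇒isotopic α β γ p =
    α , α , δ , hom⇒maps L M α α δ hom
    where
    -- `∘ₚ` composes from left to right, so `δ` sends z to γ(α⁻¹βz) = γw.
    δ = β ∘ₚ Perm.flip α ∘ₚ γ

    hom : ∀ x y → cell M (α ⟨$⟩ʳ x) (α ⟨$⟩ʳ y) ≡ δ ⟨$⟩ʳ cell L x y
    -- A second use of the paratopism, on (w, y, v) ∈ L, gives M(αy, βv) = γw, in which βv is αx.
    hom x y = symᴹ (subst (λ u → cell M (α ⟨$⟩ʳ y) u ≡ γ ⟨$⟩ʳ w) βv≡αx (to (p w y v) (symᴸ ywv∈L)))
      where
      z = cell L x y
      v = β ⟨$⟩ˡ (α ⟨$⟩ʳ x)
      w = α ⟨$⟩ˡ (β ⟨$⟩ʳ z)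

      βv≡αx : β ⟨$⟩ʳ v ≡ α ⟨$⟩ʳ x
      βv≡αx = Perm.inverseʳ β

      αw≡βz : α ⟨$⟩ʳ w ≡ β ⟨$⟩ʳ z
      αw≡βz = Perm.inverseʳ α

      ywv∈L : cell L y w ≡ v
      ywv∈L = from (p y w v) (begin
        cell M (α ⟨$⟩ʳ w) (β ⟨$⟩ʳ v)   ≡⟨ cong₂ (cell M) αw≡βz βv≡αx ⟩
        cell M (β ⟨$⟩ʳ z) (α ⟨$⟩ʳ x)   ≡⟨ symᴹ (to (p y x z) (symᴸ refl)) ⟩
        γ ⟨$⟩ʳ y                      ∎)

  private
    -- `i`, `j`, `k` are the coordinates of L that feed the row, column and symbol of M. If `k` is
    -- `2F`, the paratopism is an isotopism up to transposing. The other four cases become the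
    -- cyclic one after transposing L, M, both or neither.
    byCoordinates :
      (α β γ : Permutation′ n) (i j k : Fin 3) → i ≢ j → i ≢ k → j ≢ k →
      (∀ t → (L ∋ t) ⇔ (cell M (α ⟨$⟩ʳ t i) (β ⟨$⟩ʳ t j) ≡ γ ⟨$⟩ʳ t k)) →
      Isotopic L M
    byCoordinates α β γ 0F 1F 2F _ _ _ p = α , β , γ , p
    byCoordinates α β γ 1F 0F 2F _ _ _ p =
      β , α , γ , hom⇒maps L M β α γ (λ r c → symᴹ (to (p (tri r c (cell L r c))) refl))
    byCoordinates α β γ 1F 2F 0F _ _ _ p =
      cyclicParatopism⇒isotopic α β γ (λ x y z → p (tri x y z))
    byCoordinates α β γ 2F 1F 0F _ _ _ p =
      cyclicParatopism⇒isotopic β α γ (λ x y z →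
        mk⇔ (symᴹ ∘ to (p (tri x y z))) (from (p (tri x y z)) ∘ symᴹ))
    byCoordinates α β γ 0F 2F 1F _ _ _ p =
      cyclicParatopism⇒isotopic α β γ (λ x y z →
        mk⇔ (to (p (tri y x z)) ∘ symᴸ) (symᴸ ∘ from (p (tri y x z))))
    byCoordinates α β γ 2F 0F 1F _ _ _ p =
      cyclicParatopism⇒isotopic β α γ (λ x y z →
        mk⇔ (symᴹ ∘ to (p (tri y x z)) ∘ symᴸ) (symᴸ ∘ from (p (tri y x z)) ∘ symᴹ))
    byCoordinates α β γ 0F 0F _  i≢j _ _ _ = contradiction refl i≢j
    byCoordinates α β γ 1F 1F _  i≢j _ _ _ = contradiction refl i≢j
    byCoordinates α β γ 2F 2F _  i≢j _ _ _ = contradiction refl i≢j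
    byCoordinates α β γ 0F _  0F _ i≢k _ _ = contradiction refl i≢k
    byCoordinates α β γ 1F _  1F _ i≢k _ _ = contradiction refl i≢k
    byCoordinates α β γ 2F _  2F _ i≢k _ _ = contradiction refl i≢k
    byCoordinates α β γ _  0F 0F _ _ j≢k _ = contradiction refl j≢k
    byCoordinates α β γ _  1F 1F _ _ j≢k _ = contradiction refl j≢k
    byCoordinates α β γ _  2F 2F _ _ j≢k _ = contradiction refl j≢k

  symmetric-paratopic⇒isotopic : Paratopic L M → Isotopic L M
  symmetric-paratopic⇒isotopic (σ , α , β , γ , p) =
    byCoordinates α β γ (σ ⟨$⟩ʳ 0F) (σ ⟨$⟩ʳ 1F) (σ ⟨$⟩ʳ 2F)
      ((λ ()) ∘ permutation-injective σ) ((λ ()) ∘ permutation-injective σ)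
      ((λ ()) ∘ permutation-injective σ) p

-- Isotopisms between idempotent symmetric squares of odd order

halve : ∀ n → ∃ λ q → n ≡ q + q ⊎ n ≡ suc (q + q)
halve zero = 0 , inj₁ refl
halve (suc n) with halve n
... | q , inj₁ n≡q+q   = q , inj₂ (cong suc n≡q+q)
... | q , inj₂ n≡1+q+q = suc q , inj₁ (cong suc (trans n≡1+q+q (sym (ℕ.+-suc q q))))

module SelfAdjoint (odd : n % 2 ≡ 1) (L : LatinSquare n) (φ : Fin n → Fin n)
                   (φ-inj : Injective _≡_ _≡_ φ)
                   (adjoint : ∀ x y → cell L (φ x) y ≡ cell L x (φ y)) where

  fold-injective : ∀ k {x y} → fold x φ k ≡ fold y φ k → x ≡ y
  fold-injective zero    eq = eq
  fold-injective (suc k) eq = fold-injective k (φ-inj eq)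

  fold-shift : ∀ k x → fold (φ x) φ k ≡ φ (fold x φ k)
  fold-shift zero    x = refl
  fold-shift (suc k) x = cong φ (fold-shift k x)

  fold-adjoint : ∀ k x y → cell L (fold x φ k) y ≡ cell L x (fold y φ k)
  fold-adjoint zero    x y = refl
  fold-adjoint (suc k) x y = begin
    cell L (φ (fold x φ k)) y   ≡⟨ adjoint _ _ ⟩
    cell L (fold x φ k) (φ y)   ≡⟨ fold-adjoint k x (φ y) ⟩
    cell L x (fold (φ y) φ k)   ≡⟨ cong (cell L x) (fold-shift k y) ⟩
    cell L x (φ (fold y φ k))   ∎

  -- `fold x φ k` is the k-th power of φ at x. Moving that power across L and cancelling in row `x`
  -- shows that a power with one fixed point is the identity.
  semiregular : ∀ k {x} → fold x φ k ≡ x → ∀ y → fold y φ k ≡ y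
  semiregular k {x} fixed y = rowInj L x (begin
    cell L x (fold y φ k)   ≡⟨ fold-adjoint k x y ⟨
    cell L (fold x φ k) y   ≡⟨ cong (λ u → cell L u y) fixed ⟩
    cell L x y              ∎)

  OddPeriod : Set
  OddPeriod = ∃ λ j → ∀ x → fold x φ (suc (j + j)) ≡ x

  -- Descent on the period: if it is 2m, the m-th power of φ is an involution on a set of odd size,
  -- so it has a fixed point, and by semiregularity m is already a period.
  period⇒oddPeriod : ∀ k → 0 < k → (∀ x → fold x φ k ≡ x) → OddPeriod
  period⇒oddPeriod = <-rec _ go
    where
    go : ∀ k → (∀ {m} → m < k → 0 < m → (∀ x → fold x φ m ≡ x) → OddPeriod) →
         0 < k → (∀ x → fold x φ k ≡ x) → OddPeriod
    go k rec 0<k per with halve k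
    go k rec 0<k per | j , inj₂ refl = j , per
    go k rec 0<k per | suc q , inj₁ refl =
      rec (s<s (ℕ.m<m+n q z<s)) z<s (semiregular (suc q) (proj₂ fixed))
      where
      fixed : ∃ λ x → fold x φ (suc q) ≡ x
      fixed = involution-fixedPoint odd (λ x → fold x φ (suc q))
        (λ x → trans (sym (fold-+ x φ (suc q))) (per x))

  oddPeriod : OddPeriod
  oddPeriod
    -- The identity involution merely provides a point: a set of odd size is nonempty.
    with x , _ ← involution-fixedPoint odd (λ x → x) (λ _ → refl)
    -- Among the n + 1 iterates of `x` with exponents 0 to n two coincide; cancelling the shorter
    -- power leaves a return after `suc d` steps.
    with i , j , i<j , eq ← pigeonhole (ℕ.n<1+n n) (λ i → fold x φ (toℕ i))
    with d , j≡ ← ℕ.m≤n⇒∃[o]m+o≡n i<j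
    = period⇒oddPeriod (suc d) z<s (semiregular (suc d) (fold-injective (toℕ i) (begin
        fold (fold x φ (suc d)) φ (toℕ i)   ≡⟨ fold-+ x φ (toℕ i) ⟨
        fold x φ (toℕ i + suc d)            ≡⟨ cong (fold x φ) (trans (ℕ.+-suc (toℕ i) d) j≡) ⟩
        fold x φ (toℕ j)                    ≡⟨ eq ⟨
        fold x φ (toℕ i)                    ∎)))

isotopic⇒isomorphic : n % 2 ≡ 1 → (L M : LatinSquare n) →
                      Idempotent L → Symmetric L → Idempotent M → Symmetric M →
                      Isotopic L M → Isomorphic L M
isotopic⇒isomorphic {n} odd L M L-idem L-sym M-idem M-sym (α , β , γ , m) =
  γ , hom⇒maps L M γ γ γ (λ x y → trans (sym (cong₂ (cell M) (αψ≡γ x) (αψ≡γ y))) (αψ-hom x y))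
  where
  hom = maps⇒hom L M α β γ m

  φ : Fin n → Fin n
  φ x = α ⟨$⟩ˡ (β ⟨$⟩ʳ x)

  αφ≡β : ∀ x → α ⟨$⟩ʳ φ x ≡ β ⟨$⟩ʳ x
  αφ≡β x = Perm.inverseʳ α

  γL[φx,y] : ∀ x y → γ ⟨$⟩ʳ cell L (φ x) y ≡ cell M (β ⟨$⟩ʳ x) (β ⟨$⟩ʳ y)
  γL[φx,y] x y = trans (sym (hom (φ x) y)) (cong (λ u → cell M u (β ⟨$⟩ʳ y)) (αφ≡β x))

  adjoint : ∀ x y → cell L (φ x) y ≡ cell L x (φ y)
  -- Under γ the left side becomes M(βx, βy), which is symmetric in x and y.
  adjoint x y = permutation-injective γ (begin
    γ ⟨$⟩ʳ cell L (φ x) y             ≡⟨ γL[φx,y] x y ⟩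
    cell M (β ⟨$⟩ʳ x) (β ⟨$⟩ʳ y)       ≡⟨ M-sym _ _ ⟩
    cell M (β ⟨$⟩ʳ y) (β ⟨$⟩ʳ x)       ≡⟨ γL[φx,y] y x ⟨
    γ ⟨$⟩ʳ cell L (φ y) x             ≡⟨ cong (γ ⟨$⟩ʳ_) (L-sym _ _) ⟩
    γ ⟨$⟩ʳ cell L x (φ y)             ∎)

  open SelfAdjoint odd L φ
    (permutation-injective β ∘ permutation-injective (Perm.flip α)) adjoint

  j = proj₁ oddPeriod

  -- φ has order dividing 2j + 1, so ψ is the square root of φ in ⟨φ⟩.
  ψ : Fin n → Fin n
  ψ x = fold x φ (suc j)

  αψ-hom : ∀ x y → cell M (α ⟨$⟩ʳ ψ x) (α ⟨$⟩ʳ ψ y) ≡ γ ⟨$⟩ʳ cell L x y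
  αψ-hom x y = begin
    -- One factor φ of ψy is spent on turning α into β, so that (α, β, γ) applies; self-adjointness
    -- then gathers the remaining powers on y.
    cell M (α ⟨$⟩ʳ ψ x) (α ⟨$⟩ʳ ψ y)            ≡⟨ cong (cell M _) (αφ≡β _) ⟩
    cell M (α ⟨$⟩ʳ ψ x) (β ⟨$⟩ʳ fold y φ j)     ≡⟨ hom _ _ ⟩
    γ ⟨$⟩ʳ cell L (ψ x) (fold y φ j)           ≡⟨ cong (γ ⟨$⟩ʳ_) (fold-adjoint (suc j) x _) ⟩
    γ ⟨$⟩ʳ cell L x (fold (fold y φ j) φ (suc j))
      -- The total exponent `suc j + j` is the odd period `suc (j + j)`.
      ≡⟨ cong (λ u → γ ⟨$⟩ʳ cell L x u) (trans (sym (fold-+ y φ (suc j))) (proj₂ oddPeriod y)) ⟩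
    γ ⟨$⟩ʳ cell L x y                          ∎

  αψ≡γ : ∀ x → α ⟨$⟩ʳ ψ x ≡ γ ⟨$⟩ʳ x
  αψ≡γ x = begin
    α ⟨$⟩ʳ ψ x                           ≡⟨ M-idem _ ⟨
    cell M (α ⟨$⟩ʳ ψ x) (α ⟨$⟩ʳ ψ x)     ≡⟨ αψ-hom x x ⟩
    γ ⟨$⟩ʳ cell L x x                   ≡⟨ cong (γ ⟨$⟩ʳ_) (L-idem x) ⟩
    γ ⟨$⟩ʳ x                            ∎

-- Constructing symmetric squares

symmetricSquare : (T : Fin n → Fin n → Fin n) → (∀ r c → T r c ≡ T c r) →
                  (∀ r → Injective _≡_ _≡_ (T r)) → LatinSquare n
symmetricSquare T T-sym T-inj = record
  { cell   = T
  ; rowInj = T-inj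
  ; colInj = λ c eq → T-inj c (trans (T-sym c _) (trans eq (T-sym _ c)))
  }

record IdempotentSymmetric (n : ℕ) : Set where
  constructor idempotentSymmetric
  field
    square     : LatinSquare n
    idempotent : Idempotent square
    symmetric  : Symmetric square

open IdempotentSymmetric

-- Symmetric squares of odd order

module _ (odd : n % 2 ≡ 1) (L : LatinSquare n) (L-sym : Symmetric L) where

  diagonal-surjective : StrictlySurjective _≡_ (λ i → cell L i i)
  diagonal-surjective s =
    proj₁ fixed , trans (cong (cell L _) (sym (proj₂ fixed))) (L[r,column] _)
    where
    column : Fin n → Fin n
    column r = proj₁ (injective⇒surjective (rowInj L r) s)

    L[r,column] : ∀ r → cell L r (column r) ≡ s
    L[r,column] r = proj₂ (injective⇒surjective (rowInj L r) s)

    fixed : ∃ λ r → column r ≡ r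
    -- By symmetry row `column r` has `s` in column `r`, so applying `column` twice returns `r`.
    fixed = involution-fixedPoint odd column λ r →
      rowInj L (column r) (trans (L[r,column] (column r)) (trans (sym (L[r,column] r)) (L-sym _ _)))

  symmetric⇒isotopic-idempotent : ∃ λ (I : IdempotentSymmetric n) → Isotopic L (square I)
  symmetric⇒isotopic-idempotent =
    idempotentSymmetric L′ γL[x,x] (λ r c → cong γ (L-sym r c)) ,
    Perm.id , Perm.id , π , hom⇒maps L L′ Perm.id Perm.id π (λ _ _ → refl)
    where
    γ : Fin n → Fin n
    γ s = proj₁ (diagonal-surjective s)

    L[γ,γ] : ∀ s → cell L (γ s) (γ s) ≡ s
    L[γ,γ] s = proj₂ (diagonal-surjective s)

    γ-inj : Injective _≡_ _≡_ γ
    γ-inj eq = trans (sym (L[γ,γ] _)) (trans (cong₂ (cell L) eq eq) (L[γ,γ] _))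

    -- `γ` was chosen only as a section of the diagonal map; being injective on a finite set it is
    -- surjective, hence a two-sided inverse.
    γL[x,x] : ∀ x → γ (cell L x x) ≡ x
    γL[x,x] x with s , refl ← injective⇒surjective γ-inj x = cong γ (L[γ,γ] s)

    π : Permutation′ n
    π = Perm.permutation γ (λ x → cell L x x) γL[x,x] L[γ,γ]

    L′ : LatinSquare n
    L′ = symmetricSquare (λ r c → γ (cell L r c)) (λ r c → cong γ (L-sym r c))
           (λ r → rowInj L r ∘ γ-inj)

-- Bordering: order n idempotent versus order n + 1 unipotent reduced

-- In row suc i of the bordered square, the symbol suc i moves to column zero
-- and leaves zero on the diagonal.
bump : Fin n → Fin n → Fin (suc n)
bump i s with s ≟ i
... | yes _ = zero
... | no  _ = suc s

unbump : Fin n → Fin (suc n) → Fin n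
unbump i zero    = i
unbump i (suc s) = s

bump-refl : (i : Fin n) → bump i i ≡ zero
bump-refl i with i ≟ i
... | yes _   = refl
... | no  i≢i = contradiction refl i≢i

bump-≢ : {i s : Fin n} → s ≢ i → bump i s ≡ suc s
bump-≢ {i = i} {s} s≢i with s ≟ i
... | yes s≡i = contradiction s≡i s≢i
... | no  _   = refl

bump≢suc : (i s : Fin n) → suc i ≢ bump i s
bump≢suc i s eq with s ≟ i
... | yes _ = 0≢1+n (sym eq)
... | no s≢i = s≢i (sym (suc-injective eq))

unbump-bump : (i s : Fin n) → unbump i (bump i s) ≡ s
unbump-bump i s with s ≟ i
... | yes s≡i = sym s≡i
... | no  _   = refl

-- `suc i` is the one value that `bump i` misses: the bordered row keeps it in column zero.
bump-unbump : (i : Fin n) {a : Fin (suc n)} → a ≢ suc i → bump i (unbump i a) ≡ a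
bump-unbump i {zero}  _ = bump-refl i
bump-unbump i {suc s} a≢ = bump-≢ (a≢ ∘ cong suc)

bump-injective : (i : Fin n) → Injective _≡_ _≡_ (bump i)
bump-injective i {s} {t} eq =
  trans (sym (unbump-bump i s)) (trans (cong (unbump i) eq) (unbump-bump i t))

-- `bump` depends only on whether its arguments are equal, and `lift₀` fixes zero; hence
-- isomorphisms extend to bordered squares.
bump-lift₀ : (α : Permutation′ n) (i s : Fin n) →
             bump (α ⟨$⟩ʳ i) (α ⟨$⟩ʳ s) ≡ Perm.lift₀ α ⟨$⟩ʳ bump i s
bump-lift₀ α i s with s ≟ i
... | yes refl = bump-refl (α ⟨$⟩ʳ i)
... | no  s≢i  = bump-≢ (s≢i ∘ permutation-injective α)

UnipotentSymmetricReduced : LatinSquare (suc n) → Set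
UnipotentSymmetricReduced U = Unipotent U × Symmetric U × Reduced U

module _ (I : IdempotentSymmetric n) where
  private
    L = square I

    T : Fin (suc n) → Fin (suc n) → Fin (suc n)
    T zero    c       = c
    T (suc i) zero    = suc i
    T (suc i) (suc j) = bump i (cell L i j)

    T-sym : ∀ r c → T r c ≡ T c r
    T-sym zero    zero    = refl
    T-sym zero    (suc _) = refl
    T-sym (suc _) zero    = refl
    T-sym (suc i) (suc j) with i ≟ j
    ... | yes refl = refl
    -- Idempotence keeps `i` and `j` on the diagonal in their own rows, so off the diagonal both
    -- bumps are plain `suc`.
    ... | no  i≢j  = begin
      bump i (cell L i j)   ≡⟨ bump-≢ (λ eq → i≢j (rowInj L i (trans (idempotent I i) (sym eq)))) ⟩
      suc (cell L i j)      ≡⟨ cong suc (symmetric I i j) ⟩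
      suc (cell L j i)      ≡⟨ bump-≢ (λ eq → i≢j (rowInj L j (trans eq (sym (idempotent I j))))) ⟨
      bump j (cell L j i)   ∎

    T-inj : ∀ r → Injective _≡_ _≡_ (T r)
    T-inj zero    eq = eq
    T-inj (suc i) {zero}  {zero}  eq = refl
    T-inj (suc i) {zero}  {suc k} eq = contradiction eq (bump≢suc i _)
    T-inj (suc i) {suc j} {zero}  eq = contradiction (sym eq) (bump≢suc i _)
    T-inj (suc i) {suc j} {suc k} eq = cong suc (rowInj L i (bump-injective i eq))

  border : LatinSquare (suc n)
  border = symmetricSquare T T-sym T-inj

  border-diagonal : ∀ i → cell border i i ≡ zero
  border-diagonal zero    = refl
  border-diagonal (suc i) = trans (cong (bump i) (idempotent I i)) (bump-refl i)

  border-unipotentSymmetricReduced : UnipotentSymmetricReduced border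
  border-unipotentSymmetricReduced =
    (λ i j → trans (border-diagonal i) (sym (border-diagonal j))) ,
    T-sym ,
    (λ _ → refl) , λ i → T-sym i zero

module _ (U : LatinSquare (suc n)) (usr : UnipotentSymmetricReduced U) where
  private
    U-uni = proj₁ usr
    U-sym = proj₁ (proj₂ usr)
    U-row = proj₁ (proj₂ (proj₂ usr))
    U-col = proj₂ (proj₂ (proj₂ usr))

    T : Fin n → Fin n → Fin n
    T i j = unbump i (cell U (suc i) (suc j))

    -- Since U is reduced, column zero already holds `suc i` in this row.
    U≢suc : ∀ i j → cell U (suc i) (suc j) ≢ suc i
    U≢suc i j eq = 0≢1+n (sym (rowInj U (suc i) (trans eq (sym (U-col (suc i))))))

    U-diagonal : ∀ i → cell U i i ≡ zero
    U-diagonal i = trans (U-uni i zero) (U-row zero)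

    bump-T : ∀ i j → bump i (T i j) ≡ cell U (suc i) (suc j)
    bump-T i j = bump-unbump i (U≢suc i j)

    -- Zero occupies the diagonal cell of the row, so elsewhere `unbump i` strips a `suc` whatever
    -- `i` is. This transfers the symmetry of U to `T`.
    suc-T : ∀ {i j} → i ≢ j → suc (T i j) ≡ cell U (suc i) (suc j)
    suc-T {i} {j} i≢j with cell U (suc i) (suc j) in eq
    ... | zero  = contradiction (suc-injective (rowInj U (suc i) (trans (U-diagonal (suc i)) (sym eq)))) i≢j
    ... | suc _ = refl

    T-sym : ∀ i j → T i j ≡ T j i
    T-sym i j with i ≟ j
    ... | yes refl = refl
    ... | no  i≢j  =
      suc-injective (trans (suc-T i≢j) (trans (U-sym _ _) (sym (suc-T (≢-sym i≢j)))))

    T-inj : ∀ i → Injective _≡_ _≡_ (T i)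
    T-inj i {j} {k} eq = suc-injective (rowInj U (suc i)
      (trans (sym (bump-T i j)) (trans (cong (bump i) eq) (bump-T i k))))

  unborder : IdempotentSymmetric n
  unborder = idempotentSymmetric
    (symmetricSquare T T-sym T-inj) (λ i → cong (unbump i) (U-diagonal (suc i))) T-sym

  isomorphic-border-unborder : Isomorphic U (border unborder)
  isomorphic-border-unborder = cells≗⇒isomorphic U (border unborder) eq
    where
    eq : ∀ r c → cell U r c ≡ cell (border unborder) r c
    eq zero    c       = U-row c
    eq (suc i) zero    = U-col (suc i)
    eq (suc i) (suc j) = sym (bump-T i j)

isomorphic-border : (I J : IdempotentSymmetric n) → Isomorphic (square I) (square J) →
                    Isomorphic (border I) (border J)
isomorphic-border I J (α , m) = α⁺ , hom⇒maps (border I) (border J) α⁺ α⁺ α⁺ hom⁺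
  where
  α⁺ = Perm.lift₀ α

  hom⁺ : ∀ r c → cell (border J) (α⁺ ⟨$⟩ʳ r) (α⁺ ⟨$⟩ʳ c) ≡ α⁺ ⟨$⟩ʳ cell (border I) r c
  hom⁺ zero    c       = refl
  hom⁺ (suc i) zero    = refl
  hom⁺ (suc i) (suc j) = trans
    (cong (bump (α ⟨$⟩ʳ i)) (maps⇒hom (square I) (square J) α α α m i j))
    (bump-lift₀ α i _)

isomorphic-border⁻ : (I J : IdempotentSymmetric n) → Isomorphic (border I) (border J) →
                     Isomorphic (square I) (square J)
isomorphic-border⁻ I J (α⁺ , m) = α , hom⇒maps (square I) (square J) α α α hom
  where
  hom⁺ = maps⇒hom (border I) (border J) α⁺ α⁺ α⁺ m

  α⁺-zero : α⁺ ⟨$⟩ʳ zero ≡ zero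
  -- Zero is the entry at (zero, zero), so its image is a diagonal entry of `border J`, which is
  -- again zero. Thus `α⁺` restricts to the nonzero indices.
  α⁺-zero = trans (sym (hom⁺ zero zero)) (border-diagonal J (α⁺ ⟨$⟩ʳ zero))

  α = Perm.remove zero α⁺

  lift : ∀ i → Perm.lift₀ α ⟨$⟩ʳ i ≡ α⁺ ⟨$⟩ʳ i
  lift = Perm.lift₀-remove α⁺ α⁺-zero

  hom : ∀ i j → cell (square J) (α ⟨$⟩ʳ i) (α ⟨$⟩ʳ j) ≡ α ⟨$⟩ʳ cell (square I) i j
  hom i j = bump-injective (α ⟨$⟩ʳ i) (begin
    bump (α ⟨$⟩ʳ i) (cell (square J) (α ⟨$⟩ʳ i) (α ⟨$⟩ʳ j))   ≡⟨ cong₂ (cell (border J)) (lift (suc i)) (lift (suc j)) ⟩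
    cell (border J) (α⁺ ⟨$⟩ʳ suc i) (α⁺ ⟨$⟩ʳ suc j)           ≡⟨ hom⁺ (suc i) (suc j) ⟩
    α⁺ ⟨$⟩ʳ bump i (cell (square I) i j)                     ≡⟨ lift (bump i (cell (square I) i j)) ⟨
    Perm.lift₀ α ⟨$⟩ʳ bump i (cell (square I) i j)           ≡⟨ bump-lift₀ α i _ ⟨
    bump (α ⟨$⟩ʳ i) (α ⟨$⟩ʳ cell (square I) i j)             ∎)

-- Counting isomorphism classes

-- A finite search: a permutation is coded by two numbers below `n ^ n`, one for the function and
-- one for its inverse.
isomorphic? : (L M : LatinSquare n) → Dec (Isomorphic L M)
isomorphic? {n} L M = map′ decode encode
  (any? λ a → any? λ b → inverse? a b ×-dec inverse? b a ×-dec hom? a)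
  where
  fn : Fin (n ^ n) → Fin n → Fin n
  fn = finToFun

  Inverse : Fin (n ^ n) → Fin (n ^ n) → Set
  Inverse a b = ∀ x → fn a (fn b x) ≡ x

  Hom : Fin (n ^ n) → Set
  Hom a = ∀ r c → cell M (fn a r) (fn a c) ≡ fn a (cell L r c)

  inverse? : ∀ a b → Dec (Inverse a b)
  inverse? a b = all? λ x → fn a (fn b x) ≟ x

  hom? : ∀ a → Dec (Hom a)
  hom? a = all? λ r → all? λ c → cell M (fn a r) (fn a c) ≟ fn a (cell L r c)

  decode : (∃ λ a → ∃ λ b → Inverse a b × Inverse b a × Hom a) → Isomorphic L M
  decode (a , b , ab , ba , hom) = α , hom⇒maps L M α α α hom
    where α = Perm.permutation (fn a) (fn b) ab ba

  encode : Isomorphic L M → ∃ λ a → ∃ λ b → Inverse a b × Inverse b a × Hom a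
  encode (α , m) = a , b , ab , ba , hom
    where
    a = funToFin (α ⟨$⟩ʳ_)
    b = funToFin (α ⟨$⟩ˡ_)

    fa : ∀ x → fn a x ≡ α ⟨$⟩ʳ x
    fa = finToFun-funToFin (α ⟨$⟩ʳ_)

    fb : ∀ x → fn b x ≡ α ⟨$⟩ˡ x
    fb = finToFun-funToFin (α ⟨$⟩ˡ_)

    ab : Inverse a b
    ab x = trans (fa _) (trans (cong (α ⟨$⟩ʳ_) (fb x)) (Perm.inverseʳ α))

    ba : Inverse b a
    ba x = trans (fb _) (trans (cong (α ⟨$⟩ˡ_) (fa x)) (Perm.inverseˡ α))

    hom : Hom a
    hom r c = trans (cong₂ (cell M) (fa r) (fa c)) (trans (maps⇒hom L M α α α m r c) (sym (fa _)))

isomorphism-decSetoid : ℕ → DecSetoid 0ℓ 0ℓ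
isomorphism-decSetoid n = record
  { Carrier = IdempotentSymmetric n
  ; _≈_ = λ I J → Isomorphic (square I) (square J)
  ; isDecEquivalence = record
    { isEquivalence = record
      { refl  = λ {I} → cells≗⇒isomorphic (square I) (square I) (λ _ _ → refl)
      ; sym   = λ {I} {J} → isomorphic-sym {L = square I} {square J}
      ; trans = λ {I} {J} {K} → isomorphic-trans {L = square I} {square J} {square K}
      }
    ; _≟_ = λ I J → isomorphic? (square I) (square J)
    }
  }

-- All tables are coded by numbers below `(n ^ n) ^ n` and filtered. A decoded square matches the
-- given one cell by cell, so completeness is stated up to isomorphism.
allIdempotentSymmetric : ∀ n → ∃ λ (Is : List (IdempotentSymmetric n)) →
                         ∀ I → Any (λ J → Isomorphic (square I) (square J)) Is
allIdempotentSymmetric n = concatMap squares (allFin _) , complete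
  where
  table : Fin ((n ^ n) ^ n) → Fin n → Fin n → Fin n
  table a r = finToFun (finToFun {n ^ n} {n} a r)

  Valid : Fin ((n ^ n) ^ n) → Set
  Valid a = (∀ i → table a i i ≡ i) × (∀ r c → table a r c ≡ table a c r) ×
            (∀ r c d → table a r c ≡ table a r d → c ≡ d)

  valid? : ∀ a → Dec (Valid a)
  valid? a =
    (all? λ i → table a i i ≟ i) ×-dec
    (all? λ r → all? λ c → table a r c ≟ table a c r) ×-dec
    (all? λ r → all? λ c → all? λ d → (table a r c ≟ table a r d) →-dec (c ≟ d))

  decode : ∀ a → Valid a → IdempotentSymmetric n
  decode a (idem , symm , inj) =
    idempotentSymmetric (symmetricSquare (table a) symm (λ r → inj r _ _)) idem symm

  squares : Fin ((n ^ n) ^ n) → List (IdempotentSymmetric n)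
  squares a with valid? a
  ... | yes valid = [ decode a valid ]
  ... | no  _     = []

  complete : ∀ I → Any (λ J → Isomorphic (square I) (square J)) (concatMap squares (allFin _))
  complete I = Any.concatMap⁺ squares (lose (∈-allFin a) found)
    where
    L = square I
    a = funToFin (λ r → funToFin (cell L r))

    a-table : ∀ r c → table a r c ≡ cell L r c
    a-table r c = trans
      (cong (λ b → finToFun b c) (finToFun-funToFin (λ r → funToFin (cell L r)) r))
      (finToFun-funToFin (cell L r) c)

    a-valid : Valid a
    a-valid =
      (λ i → trans (a-table i i) (idempotent I i)) ,
      (λ r c → trans (a-table r c) (trans (symmetric I r c) (sym (a-table c r)))) ,
      (λ r c d eq → rowInj L r (trans (sym (a-table r c)) (trans eq (a-table r d))))

    found : Any (λ J → Isomorphic L (square J)) (squares a)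
    found with valid? a
    ... | yes valid  = here (cells≗⇒isomorphic L (square (decode a valid)) (λ r c → sym (a-table r c)))
    ... | no  ¬valid = contradiction a-valid ¬valid

-- `AllPairs` compares only earlier entries with later ones; symmetry of the relation handles the
-- opposite order.
allPairs-lookup : {A : Set} {_≈_ : A → A → Set} → (∀ {x y} → x ≈ y → y ≈ x) →
                  {xs : List A} → AllPairs (λ x y → ¬ (x ≈ y)) xs →
                  ∀ i j → lookup xs i ≈ lookup xs j → i ≡ j
allPairs-lookup ≈-sym (x≉ ∷ _)  zero    zero    _  = refl
allPairs-lookup ≈-sym (x≉ ∷ _)  zero    (suc j) eq = contradiction eq (All.lookup x≉ (∈-lookup j))
allPairs-lookup ≈-sym (x≉ ∷ _)  (suc i) zero    eq = contradiction (≈-sym eq) (All.lookup x≉ (∈-lookup i))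
allPairs-lookup ≈-sym (_ ∷ xs!) (suc i) (suc j) eq = cong suc (allPairs-lookup ≈-sym xs! i j eq)

-- Deduplication by decidable isomorphism keeps one square per class: every discarded square is
-- isomorphic to a kept one.
representatives : ∀ n → ∃ λ k → Σ (Fin k → IdempotentSymmetric n) λ rep →
                  (∀ i j → Isomorphic (square (rep i)) (square (rep j)) → i ≡ j) ×
                  (∀ I → ∃ λ i → Isomorphic (square I) (square (rep i)))
representatives n = length reps , lookup reps ,
  allPairs-lookup (λ {I} {J} → S.sym {I} {J}) (deduplicate-! (isomorphism-decSetoid n) Is) ,
  λ I → let found = Any.deduplicate⁺ S._≟_ (λ {J} {K} K≈J I≈J → S.trans {I} {J} {K} I≈J (S.sym {K} {J} K≈J)) (complete I)
        in Any.index found , Any.lookup-index found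
  where
  module S = DecSetoid (isomorphism-decSetoid n)
  Is = proj₁ (allIdempotentSymmetric n)
  complete = proj₂ (allIdempotentSymmetric n)
  reps = deduplicate S._≟_ Is

-- Equality of the seven counts

theorem7 : (n : ℕ) → n % 2 ≡ 1 →
    ∃ λ k →
    NumClasses {n} Paratopic Symmetric k ×
    NumClasses {n} Paratopic (λ L → Diagonal L × Symmetric L) k ×
    NumClasses {n} Paratopic (λ L → Idempotent L × Symmetric L) k ×
    NumClasses {n} Isotopic (λ L → Idempotent L × Symmetric L) k ×
    NumClasses {n} RRSIsotopic (λ L → Idempotent L × Symmetric L) k ×
    NumClasses {n} Isomorphic (λ L → Idempotent L × Symmetric L) k ×
    NumClasses {suc n} Isomorphic (λ L → Unipotent L × Symmetric L × Reduced L) k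
theorem7 n odd with representatives n
-- The same `k` squares serve the first six counts: covering passes from isomorphism to the coarser
-- relations, and separation does so because the coarser relations imply isomorphism on these
-- squares. Their borders serve the last count.
... | k , rep , separated , covering = k ,
  (sq , (λ i → symmetric (rep i)) , separated-paratopic , covering-symmetric) ,
  (sq , (λ i → diagonal i , symmetric (rep i)) , separated-paratopic ,
    λ L (_ , L-sym) → covering-symmetric L L-sym) ,
  (sq , idemSym , separated-paratopic , λ L (_ , L-sym) → covering-symmetric L L-sym) ,
  (sq , idemSym , separated-isotopic , λ L P → let i , iso = covers L P in
    i , rrsIsotopic⇒isotopic {L = L} {sq i} (isomorphic⇒rrsIsotopic {L = L} {sq i} iso)) ,
  (sq , idemSym ,
    (λ i j → separated-isotopic i j ∘ rrsIsotopic⇒isotopic {L = sq i} {sq j}) ,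
    λ L P → let i , iso = covers L P in i , isomorphic⇒rrsIsotopic {L = L} {sq i} iso) ,
  (sq , idemSym , separated , covers) ,
  (border ∘ rep , border-unipotentSymmetricReduced ∘ rep ,
    (λ i j → separated i j ∘ isomorphic-border⁻ (rep i) (rep j)) ,
    λ U P → let i , iso = covering (unborder U P) in
      i , isomorphic-trans {L = U} {border (unborder U P)} {border (rep i)}
            (isomorphic-border-unborder U P) (isomorphic-border (unborder U P) (rep i) iso))
  where
  sq : Fin k → LatinSquare n
  sq i = square (rep i)

  idemSym : ∀ i → Idempotent (sq i) × Symmetric (sq i)
  idemSym i = idempotent (rep i) , symmetric (rep i)

  diagonal : ∀ i → Diagonal (sq i)
  diagonal i eq = trans (sym (idempotent (rep i) _)) (trans eq (idempotent (rep i) _))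

  covers : ∀ L → Idempotent L × Symmetric L → ∃ λ i → Isomorphic L (sq i)
  covers L (idem , symm) = covering (idempotentSymmetric L idem symm)

  separated-isotopic : ∀ i j → Isotopic (sq i) (sq j) → i ≡ j
  separated-isotopic i j = separated i j ∘ isotopic⇒isomorphic odd (sq i) (sq j)
    (idempotent (rep i)) (symmetric (rep i)) (idempotent (rep j)) (symmetric (rep j))

  separated-paratopic : ∀ i j → Paratopic (sq i) (sq j) → i ≡ j
  separated-paratopic i j = separated-isotopic i j ∘
    symmetric-paratopic⇒isotopic (sq i) (sq j) (symmetric (rep i)) (symmetric (rep j))

  -- Relabelling first makes the square idempotent; this covers all three species counts at once.
  covering-symmetric : ∀ L → Symmetric L → ∃ λ i → Paratopic L (sq i)
  covering-symmetric L L-sym =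
    let I , L≈I = symmetric⇒isotopic-idempotent odd L L-sym
        i , I≈sq = covering I
    in i , isotopic⇒paratopic {L = L} {sq i}
             (isotopic-trans {L = L} {square I} {sq i} L≈I
               (rrsIsotopic⇒isotopic {L = square I} {sq i} (isomorphic⇒rrsIsotopic {L = square I} {sq i} I≈sq)))
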